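{- Let $\Sigma=(K,arity)$ be a signature and let $S$ be a multi-set over the relation symbols of the bigraph relational model. If $S$ is valid, then there exists a bigraph $B$ (under $\Sigma$) such that $[\![B]\!]=S$.
   Context: **Bigraphs.** A signature is $\Sigma=(K,arity)$ with $K$ a set of controls and $arity:K\to\mathbb N$. A bigraph under $\Sigma$ is $B=(V_B,E_B,P_B,ctrl_B,prnt_B,link_B):\langle m,X\rangle\to\langle n,Y\rangle$, where $m,n$ are finite ordinals (the sites, resp. roots), $X,Y,V_B,E_B$ are finite sets (inner names, outer names, nodes, edges), $ctrl_B:V_B\to K$, $P_B=\{(v,i)\mid v\in V_B,\ i\in arity(ctrl_B\,v)\}$ (ports; a natural number is the set of smaller numbers), $prnt_B:V_B\cup m\to V_B\cup n$ is total and establishes a tree-shaped (acyclic) parent ordering on the nodes, and $link_B:X\cup P_B\to E_B\cup Y$ is total. The sets $m,n,X,Y,V_B,E_B$ are assumed disjoint. **Relation symbols.** Elements of the multi-sets are facts built from names of the disjoint sorts node, root, site, port, o_name, i_name, e_name, and from controls and natural numbers in unary ($\mathtt z$, $\mathtt s\,N$). Destinations in the place graph are $\mathtt{dst\_n}\,a$ ($a$ a node), $\mathtt{dst\_r}\,r$ ($r$ a root); sources are $\mathtt{src\_n}\,a$, $\mathtt{src\_s}\,s$ ($s$ a site). In the link graph destinations are $\mathtt{dst\_o}\,o$ ($o$ an outer name), $\mathtt{dst\_e}\,e$ ($e$ an edge), and sources are $\mathtt{src\_i}\,i$ ($i$ an inner name), $\mathtt{src\_p}\,p$ ($p$ a port).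 The facts are: structural facts is_root $r$, is_node $a$, is_site $s$, is_port $p$, is_o_name $o$, is_i_name $i$, is_e_name $e$; operational facts prnt $S\,D$, link $S\,D$ ($S$ a source, $D$ a destination), lc $a\,k$ (node $a$ has control $k$), lp $p\,a$ (port $p$ belongs to node $a$), has_child_p $D\,N$, has_child_l $D\,N$, vp $a\,N$ ($a$ a node, $N$ a natural number). (The paper's extra argument naming the bigraph is omitted.) **Rewrite rules.** $\Delta$ is an arbitrary multi-set, upper-case letters are variables: (dr) {is_root $R$, has_child_p (dst_r $R$) z} $\uplus\Delta\mapsto\Delta$. (do) {is_o_name $O$, has_child_l (dst_o $O$) z} $\uplus\Delta\mapsto\Delta$. (de) {is_e_name $E$, has_child_l (dst_e $E$) z} $\uplus\Delta\mapsto\Delta$. (lgpsz) {is_port $P$, lp $P\,A$, vp $A$ (s z), link (src_p $P$) $D$, has_child_l $D$ (s $N$)} $\uplus\Delta\mapsto$ {has_child_l $D\,N$} $\uplus\Delta$. (lgi) {is_i_name $I$, link (src_i $I$) $D$, has_child_l $D$ (s $N$)} $\uplus\Delta\mapsto$ {has_child_l $D\,N$} $\uplus\Delta$. (lgs) {is_site $S$, prnt (src_s $S$) $D$, has_child_p $D$ (s $N$)} $\uplus\Delta\mapsto$ {has_child_p $D\,N$} $\uplus\Delta$. (pgnz) {is_node $A$, has_child_p (dst_n $A$) z, prnt (src_n $A$) $D$, has_child_p $D$ (s $N$), lc $A\,K$} $\uplus\Delta\mapsto$ {has_child_p $D\,N$} $\uplus\Delta$, if $arity\,K=0$. (pgns)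 {is_node $A$, has_child_p (dst_n $A$) z, prnt (src_n $A$) $D$, has_child_p $D$ (s $N$), lc $A\,K$} $\uplus\Delta\mapsto$ {has_child_p $D\,N$, vp $A\,N'$} $\uplus\Delta$, if $arity\,K=N'>0$. (lgps) {is_port $P$, lp $P\,A$, vp $A$ (s (s $N'$)), link (src_p $P$) $D$, has_child_l $D$ (s $N$)} $\uplus\Delta\mapsto$ {vp $A$ (s $N'$), has_child_l $D\,N$} $\uplus\Delta$. $S\longrightarrow S'$ denotes the reflexive-transitive closure of $\mapsto$. **Validity.** $S$ is valid iff $S\longrightarrow\emptyset$, every element of $S$ has multiplicity one, and each of has_child_p, has_child_l, vp is unique in its first argument in $S$ (for each first argument $D$, in node $\cup$ root, o_name $\cup$ e_name, node respectively, there is at most one such fact in $S$). **Encoding.** Names are chosen injectively for the nodes, edges, ports, roots, sites, inner and outer names of $B$ (the names of different sorts being distinct); an element and its name are written alike. $[\![B]\!]$ is the multi-set in which each of the following occurs exactly once: is_root $r$, has_child_p (dst_r $r$) $|prnt_B^{ -1}(r)|$ for each root $r\in n$; is_node $v$, lc $v$ $(ctrl_B\,v)$, has_child_p (dst_n $v$) $|prnt_B^{ -1}(v)|$, prnt (src_n $v$) $(prnt_B\,v)$ for each $v\in V_B$; is_site $s$, prnt (src_s $s$) $(prnt_B\,s)$ for each site $s\in m$; is_port $p$, lp $p\,v$, link (src_p $p$) $(link_B\,p)$ for each port $p=(v,i)\in P_B$; is_o_name $o$, has_child_l (dst_o $o$) $|link_B^{ -1}(o)|$ for each $o\in Y$;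 is_e_name $e$, has_child_l (dst_e $e$) $|link_B^{ -1}(e)|$ for each $e\in E_B$; is_i_name $x$, link (src_i $x$) $(link_B\,x)$ for each $x\in X$. Here $prnt_B\,v$, $link_B\,p$ etc. carry the appropriate constructor dst_n, dst_r, dst_o, dst_e. The equation $[\![B]\!]=S$ is understood for a suitable choice of the names.
   Formalization: The formal theorem additionally assumes that S contains no vp fact; without this the claim is false, e.g. for the valid S = {is_port p, lp p a, vp a (s z), link (src_p p) (dst_o o), has_child_l (dst_o o) (s z), is_o_name o}, as no encoding contains vp. -}

module Defs where

open import Data.Fin using (Fin)
import Data.Fin.Properties as Fin
open import Data.List using (List; []; _∷_; _++_; map; concatMap; filter; length; allFin)
open import Data.List.Membership.Propositional using (_∈_; _∉_)
open import Data.List.Relation.Binary.Permutation.Propositional using (_↭_)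
open import Data.List.Relation.Unary.Unique.Propositional using (Unique)
open import Data.Nat using (ℕ; zero; suc; _<_)
open import Data.Product using (Σ; _,_; ∃-syntax; _×_)
open import Data.Sum using (_⊎_; inj₁; inj₂; [_,_]′)
open import Data.Sum.Properties using (≡-dec)
open import Function using (_↔_; Inverse; Injective; _∘_)
open import Function.Properties.Inverse using (↔⇒↣)
open import Relation.Binary using (Rel; DecidableEquality)
open import Relation.Binary.Construct.Closure.ReflexiveTransitive using (Star)
open import Relation.Binary.Construct.Closure.Transitive using (TransClosure)
open import Relation.Binary.PropositionalEquality using (_≡_)
open import Relation.Nullary using (¬_)
open import Level using (0ℓ)

------------------------------------------------------------------------
-- Bigraphs

record Signature : Set₁ where
  field
    Control : Set
    arity   : Control → ℕ

record FiniteSet : Set₁ where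
  field
    Carrier     : Set
    size        : ℕ
    enumeration : Carrier ↔ Fin size

  elements : List Carrier
  elements = map (Inverse.from enumeration) (allFin size)

  _≟_ : DecidableEquality Carrier
  _≟_ = Fin.inj⇒≟ (↔⇒↣ enumeration)

open FiniteSet using (Carrier; elements)

-- The interface ⟨ n , X ⟩; the ordinal n is rendered as Fin n.
record Interface : Set₁ where
  constructor ⟨_,_⟩
  field
    width : ℕ
    names : FiniteSet

-- Unions of sets assumed disjoint are rendered as sums.
record Bigraph (𝒮 : Signature) (inner outer : Interface) : Set₁ where
  open Signature 𝒮
  open Interface inner using () renaming (width to m; names to X)
  open Interface outer using () renaming (width to n; names to Y)
  field
    V E  : FiniteSet
    ctrl : Carrier V → Control

  Site : Set
  Site = Fin m

  Root : Set
  Root = Fin n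

  Port : Set
  Port = Σ (Carrier V) λ v → Fin (arity (ctrl v))

  field
    prnt : Carrier V ⊎ Site → Carrier V ⊎ Root
    link : Carrier X ⊎ Port → Carrier E ⊎ Carrier Y

  _ChildOf_ : Rel (Carrier V) 0ℓ
  w ChildOf v = prnt (inj₁ w) ≡ inj₁ v

  field
    acyclic : ∀ v → ¬ TransClosure _ChildOf_ v v

  ports : List Port
  ports = concatMap (λ v → map (v ,_) (allFin (arity (ctrl v)))) (elements V)

  -- |prnt⁻¹(d)|
  childCount : Carrier V ⊎ Root → ℕ
  childCount d = length (filter (λ s → ≡-dec (FiniteSet._≟_ V) Fin._≟_ (prnt s) d)
                                (map inj₁ (elements V) ++ map inj₂ (allFin m)))

  -- |link⁻¹(d)|
  linkCount : Carrier E ⊎ Carrier Y → ℕ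
  linkCount d = length (filter (λ s → ≡-dec (FiniteSet._≟_ E) (FiniteSet._≟_ Y) (link s) d)
                               (map inj₁ (elements X) ++ map inj₂ ports))

------------------------------------------------------------------------
-- The relational model

data Sort : Set where
  node root site port o-name i-name e-name : Sort

module _ (𝒮 : Signature) (Name : Sort → Set) where
  open Signature 𝒮

  data PlaceDst : Set where
    dst-n : Name node → PlaceDst
    dst-r : Name root → PlaceDst

  data PlaceSrc : Set where
    src-n : Name node → PlaceSrc
    src-s : Name site → PlaceSrc

  data LinkDst : Set where
    dst-o : Name o-name → LinkDst
    dst-e : Name e-name → LinkDst

  data LinkSrc : Set where
    src-i : Name i-name → LinkSrc
    src-p : Name port → LinkSrc

  data Fact : Set where
    is-root     : Name root → Fact
    is-node     : Name node → Fact
    is-site     : Name site → Fact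
    is-port     : Name port → Fact
    is-o-name   : Name o-name → Fact
    is-i-name   : Name i-name → Fact
    is-e-name   : Name e-name → Fact
    prnt        : PlaceSrc → PlaceDst → Fact
    link        : LinkSrc → LinkDst → Fact
    lc          : Name node → Control → Fact
    lp          : Name port → Name node → Fact
    has-child-p : PlaceDst → ℕ → Fact
    has-child-l : LinkDst → ℕ → Fact
    vp          : Name node → ℕ → Fact

  -- Finite multi-sets are lists, identified up to _↭_.
  MultiSet : Set
  MultiSet = List Fact

  data Rule : MultiSet → MultiSet → Set where
    dr    : ∀ {R} → Rule (is-root R ∷ has-child-p (dst-r R) zero ∷ []) []
    do′   : ∀ {O} → Rule (is-o-name O ∷ has-child-l (dst-o O) zero ∷ []) []
    de    : ∀ {E} → Rule (is-e-name E ∷ has-child-l (dst-e E) zero ∷ []) []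
    lgpsz : ∀ {P A D N} →
            Rule (is-port P ∷ lp P A ∷ vp A (suc zero) ∷
                  link (src-p P) D ∷ has-child-l D (suc N) ∷ [])
                 (has-child-l D N ∷ [])
    lgi   : ∀ {I D N} →
            Rule (is-i-name I ∷ link (src-i I) D ∷ has-child-l D (suc N) ∷ [])
                 (has-child-l D N ∷ [])
    lgs   : ∀ {S D N} →
            Rule (is-site S ∷ prnt (src-s S) D ∷ has-child-p D (suc N) ∷ [])
                 (has-child-p D N ∷ [])
    pgnz  : ∀ {A D N K} → arity K ≡ 0 →
            Rule (is-node A ∷ has-child-p (dst-n A) zero ∷ prnt (src-n A) D ∷
                  has-child-p D (suc N) ∷ lc A K ∷ [])
                 (has-child-p D N ∷ [])
    pgns  : ∀ {A D N K N′} → arity K ≡ N′ → 0 < N′ →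
            Rule (is-node A ∷ has-child-p (dst-n A) zero ∷ prnt (src-n A) D ∷
                  has-child-p D (suc N) ∷ lc A K ∷ [])
                 (has-child-p D N ∷ vp A N′ ∷ [])
    lgps  : ∀ {P A D N N′} →
            Rule (is-port P ∷ lp P A ∷ vp A (suc (suc N′)) ∷
                  link (src-p P) D ∷ has-child-l D (suc N) ∷ [])
                 (vp A (suc N′) ∷ has-child-l D N ∷ [])

  _↦_ : Rel MultiSet 0ℓ
  S ↦ S′ = ∃[ L ] ∃[ R ] ∃[ Δ ] Rule L R × S ↭ L ++ Δ × S′ ↭ R ++ Δ

  _⟶_ : Rel MultiSet 0ℓ
  _⟶_ = Star _↦_

  -- Given `unique`, equality of the second arguments says that there is at
  -- most one fact with a given first argument, counting multiplicities.
  record Valid (S : MultiSet) : Set where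
    field
      reduces            : S ⟶ []
      unique             : Unique S
      has-child-p-unique : ∀ {D N N′} → has-child-p D N ∈ S → has-child-p D N′ ∈ S → N ≡ N′
      has-child-l-unique : ∀ {D N N′} → has-child-l D N ∈ S → has-child-l D N′ ∈ S → N ≡ N′
      vp-unique          : ∀ {A N N′} → vp A N ∈ S → vp A N′ ∈ S → N ≡ N′

  -- vp facts are counters created by rule pgns while rewriting; no encoding
  -- of a bigraph contains one.  Validity alone does not exclude them:
  --   {is-port p, lp p a, vp a 1, link (src-p p) (dst-o o),
  --    is-o-name o, has-child-l (dst-o o) 1}
  -- is valid, by lgpsz followed by do, but encodes no bigraph.
  VpFree : MultiSet → Set
  VpFree S = ∀ A N → vp A N ∉ S

------------------------------------------------------------------------
-- Encoding

  record Naming {inner outer} (B : Bigraph 𝒮 inner outer) : Set where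
    open Bigraph B
    open Interface inner using () renaming (names to X)
    open Interface outer using () renaming (names to Y)
    field
      nodeName  : Carrier V → Name node
      edgeName  : Carrier E → Name e-name
      portName  : Port → Name port
      rootName  : Root → Name root
      siteName  : Site → Name site
      innerName : Carrier X → Name i-name
      outerName : Carrier Y → Name o-name
      nodeName-injective  : Injective _≡_ _≡_ nodeName
      edgeName-injective  : Injective _≡_ _≡_ edgeName
      portName-injective  : Injective _≡_ _≡_ portName
      rootName-injective  : Injective _≡_ _≡_ rootName
      siteName-injective  : Injective _≡_ _≡_ siteName
      innerName-injective : Injective _≡_ _≡_ innerName
      outerName-injective : Injective _≡_ _≡_ outerName

    placeDst : Carrier V ⊎ Root → PlaceDst
    placeDst = [ dst-n ∘ nodeName , dst-r ∘ rootName ]′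

    linkDst : Carrier E ⊎ Carrier Y → LinkDst
    linkDst = [ dst-e ∘ edgeName , dst-o ∘ outerName ]′

  ⟦_⟧ : ∀ {inner outer} (B : Bigraph 𝒮 inner outer) → Naming B → MultiSet
  ⟦_⟧ {⟨ m , X ⟩} {⟨ n , Y ⟩} B η =
    concatMap rootFacts  (allFin n)   ++
    concatMap nodeFacts  (elements V) ++
    concatMap siteFacts  (allFin m)   ++
    concatMap portFacts  ports        ++
    concatMap outerFacts (elements Y) ++
    concatMap edgeFacts  (elements E) ++
    concatMap innerFacts (elements X)
    where
    open Bigraph B renaming (prnt to prntB; link to linkB)
    open Naming η

    rootFacts : Root → MultiSet
    rootFacts r = is-root (rootName r) ∷
                  has-child-p (dst-r (rootName r)) (childCount (inj₂ r)) ∷ []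

    nodeFacts : Carrier V → MultiSet
    nodeFacts v = is-node (nodeName v) ∷
                  lc (nodeName v) (ctrl v) ∷
                  has-child-p (dst-n (nodeName v)) (childCount (inj₁ v)) ∷
                  prnt (src-n (nodeName v)) (placeDst (prntB (inj₁ v))) ∷ []

    siteFacts : Site → MultiSet
    siteFacts s = is-site (siteName s) ∷
                  prnt (src-s (siteName s)) (placeDst (prntB (inj₂ s))) ∷ []

    portFacts : Port → MultiSet
    portFacts p@(v , _) = is-port (portName p) ∷
                          lp (portName p) (nodeName v) ∷
                          link (src-p (portName p)) (linkDst (linkB (inj₂ p))) ∷ []

    outerFacts : Carrier Y → MultiSet
    outerFacts o = is-o-name (outerName o) ∷
                   has-child-l (dst-o (outerName o)) (linkCount (inj₂ o)) ∷ []

    edgeFacts : Carrier E → MultiSet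
    edgeFacts e = is-e-name (edgeName e) ∷
                  has-child-l (dst-e (edgeName e)) (linkCount (inj₁ e)) ∷ []

    innerFacts : Carrier X → MultiSet
    innerFacts x = is-i-name (innerName x) ∷
                   link (src-i (innerName x)) (linkDst (linkB (inj₁ x))) ∷ []

module Submission where

-- Every fact of a valid multi-set is consumed during the reduction, and the
-- rules consume facts in fixed proportions.  Let f and g assign lists to
-- facts, and write Σ f S for the concatenation of f x over the facts x of S.
-- If for every rule L ↦ R there is a list C with Σ f L = C ++ Σ f R and
-- Σ g L = C ++ Σ g R, then Σ f S ↭ Σ g S for each S reducing to the empty
-- multi-set (`conservation`).  Such laws determine the shape of S:
--   * lc facts are in bijection with the nodes, and lp facts with the ports;
--   * the sources of the prnt facts are the nodes and sites, those of the
--     link facts the inner names and ports, each once;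
--   * has-child-p facts are in bijection with the nodes and roots, and
--     has-child-l facts with the edges and outer names;
--   * repeating each destination as often as its counter says gives the list
--     of the destinations of the prnt (respectively link) facts;
--   * repeating each node as often as its arity says, and each node with a
--     vp fact as often as that fact says, gives the list of the owners of
--     the ports.
-- The laws are permutations of lists of names, so no equality test on names
-- is needed.  Because S is duplicate-free the lists of names have no
-- repetitions, and their positions serve as the nodes, edges, roots, sites
-- and names of a bigraph.  `incidence` turns the laws about a family of
-- arrows and its counters into a function whose fibres have the sizes that
-- the counters record; applied twice, it yields the parent and the link map.
-- As S contains no vp fact, the last law matches the ports of S with the
-- pairs (v , i), i < arity (ctrl v).
--
-- The parent map is acyclic because a node is consumed while its parent is
-- still present: by induction on the reduction, the child relation recorded
-- by the prnt facts is well-founded (`child-wellFounded`).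

open import Defs
import Algebra.Solver.CommutativeMonoid
open import Data.Fin using (Fin)
import Data.Fin.Properties as Fin
open import Data.List using (List; []; _∷_; [_]; _++_; map; concatMap; filter; length; allFin; lookup; replicate)
open import Data.List.Properties using
  ( map-∘; map-cong; map-id; map-++; map-concatMap; map-replicate; map-tabulate; tabulate-lookup
  ; concatMap-cong; concatMap-map; concatMap-pure; concatMap-++; ++-identityʳ; ++-assoc
  ; length-replicate; filter-++; filter-all; filter-none; ∷-injectiveˡ; ∷-injectiveʳ)
open import Data.List.Membership.Propositional using (_∈_; _∉_; lose; find)
open import Data.List.Membership.Propositional.Properties using
  (∈-allFin; ∈-map⁺; ∈-map⁻; ∈-++⁺ˡ; ∈-++⁺ʳ; ∈-++⁻; ∈-concatMap⁺; ∈-concatMap⁻)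
open import Data.List.Membership.Propositional.Properties.WithK using (unique⇒irrelevant)
open import Data.List.Relation.Binary.Disjoint.Propositional using (Disjoint)
open import Data.List.Relation.Binary.Permutation.Propositional using
  (_↭_; ↭-refl; ↭-sym; ↭-trans; ↭-reflexive; module PermutationReasoning)
import Data.List.Relation.Binary.Permutation.Propositional as ↭
open import Data.List.Relation.Binary.Permutation.Propositional.Properties using
  (↭-map-inv; map⁺; ++⁺; ++⁺ˡ; shifts; filter-↭; ↭-length; ∈-resp-↭; ++-commutativeMonoid)
import Data.List.Relation.Binary.Permutation.Setoid.Properties as PermSetoid
open import Data.List.Relation.Unary.All as All using (All; []; _∷_)
import Data.List.Relation.Unary.All.Properties as All
open import Data.List.Relation.Unary.AllPairs as AllPairs using (AllPairs; []; _∷_)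
import Data.List.Relation.Unary.AllPairs.Properties as AllPairs
open import Data.List.Relation.Unary.Any using (here; there)
open import Data.List.Relation.Unary.Unique.Propositional using (Unique)
import Data.List.Relation.Unary.Unique.Propositional.Properties as Unique
open import Data.Nat using (ℕ; zero; suc)
open import Data.Product using (Σ; Σ-syntax; ∃-syntax; _×_; _,_; proj₁; proj₂; map₂)
open import Data.Sum using (_⊎_; inj₁; inj₂; [_,_]′)
open import Data.Sum.Properties using (≡-dec; inj₁-injective; inj₂-injective)
open import Function using (_∘_; id; Injective; Inverse)
open import Function.Construct.Identity using (↔-id)
open import Induction.WellFounded using (WellFounded; Acc; acc; module Subrelation; wf⇒asym)
open import Relation.Binary using (DecidableEquality)
import Relation.Binary.Construct.Closure.Transitive as Plus
open import Relation.Binary.Construct.Closure.ReflexiveTransitive using (ε; _◅_)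
import Relation.Binary.Construct.On as On
open import Relation.Binary.PropositionalEquality using
  (_≡_; _≢_; refl; sym; trans; cong; cong₂; subst; setoid; module ≡-Reasoning)
open import Relation.Nullary using (¬_; yes; no; contradiction)

-- Concatenated images of lists, up to permutation

concatMap⁺ : {X Y : Set} (f : X → List Y) {xs ys : List X} → xs ↭ ys → concatMap f xs ↭ concatMap f ys
concatMap⁺ f ↭.refl         = ↭-refl
concatMap⁺ f (↭.prep x p)   = ++⁺ˡ (f x) (concatMap⁺ f p)
concatMap⁺ f (↭.swap x y p) = ↭-trans (shifts (f x) (f y)) (++⁺ˡ (f y) (++⁺ˡ (f x) (concatMap⁺ f p)))
concatMap⁺ f (↭.trans p q)  = ↭-trans (concatMap⁺ f p) (concatMap⁺ f q)

concatMap-concatMap : {X Y Z : Set} (g : Y → List Z) (f : X → List Y) (xs : List X) →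
  concatMap g (concatMap f xs) ≡ concatMap (concatMap g ∘ f) xs
concatMap-concatMap g f []       = refl
concatMap-concatMap g f (x ∷ xs) =
  trans (concatMap-++ g (f x) (concatMap f xs)) (cong (concatMap g (f x) ++_) (concatMap-concatMap g f xs))

module _ {X Y : Set} where

  concatMap-⊕ : (u v : X → List Y) (xs : List X) →
    concatMap (λ x → u x ++ v x) xs ↭ concatMap u xs ++ concatMap v xs
  concatMap-⊕ u v []       = ↭-refl
  concatMap-⊕ u v (x ∷ xs) = ↭-trans (++⁺ˡ (u x ++ v x) (concatMap-⊕ u v xs))
    (solve 4 (λ a b c d → (a ⊕ b) ⊕ (c ⊕ d) ⊜ (a ⊕ c) ⊕ (b ⊕ d)) ↭-refl
      (u x) (v x) (concatMap u xs) (concatMap v xs))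
    where open Algebra.Solver.CommutativeMonoid (++-commutativeMonoid {A = Y})

  concatMap-[] : (xs : List X) → concatMap {B = Y} (λ _ → []) xs ≡ []
  concatMap-[] []       = refl
  concatMap-[] (_ ∷ xs) = concatMap-[] xs

  -- Exchange of a double summation.
  concatMap-swap : (hs : List (X → List Y)) (xs : List X) →
    concatMap (λ x → concatMap (λ h → h x) hs) xs ↭ concatMap (λ h → concatMap h xs) hs
  concatMap-swap []       xs = ↭-reflexive (concatMap-[] xs)
  concatMap-swap (h ∷ hs) xs =
    ↭-trans (concatMap-⊕ h (λ x → concatMap (λ h → h x) hs) xs)
            (++⁺ˡ (concatMap h xs) (concatMap-swap hs xs))

  -- A table with a row for each x and a column for each h may be listed by
  -- rows or by columns.
  rows↭columns : (hs : List (X → Y)) (xs : List X) →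
    concatMap (λ x → map (λ h → h x) hs) xs ↭ concatMap (λ h → map h xs) hs
  rows↭columns []       xs = ↭-reflexive (concatMap-[] xs)
  rows↭columns (h ∷ hs) xs =
    ↭-trans (concatMap-⊕ ([_] ∘ h) (λ x → map (λ h → h x) hs) xs)
            (++⁺ (↭-reflexive (trans (sym (concatMap-map [_] h xs)) (concatMap-pure (map h xs))))
                 (rows↭columns hs xs))

map-⊎ : {A B C D : Set} {c : C → D} {k : A ⊎ B → C} (as : List A) (bs : List B) {cs : List C} →
  cs ↭ map k (map inj₁ as ++ map inj₂ bs) →
  map c cs ↭ map (c ∘ k ∘ inj₁) as ++ map (c ∘ k ∘ inj₂) bs
map-⊎ {c = c} {k} as bs {cs} p = begin
  map c cs                                                ↭⟨ map⁺ c p ⟩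
  map c (map k (map inj₁ as ++ map inj₂ bs))              ≡⟨ map-∘ (map inj₁ as ++ map inj₂ bs) ⟨
  map (c ∘ k) (map inj₁ as ++ map inj₂ bs)                ≡⟨ map-++ (c ∘ k) (map inj₁ as) (map inj₂ bs) ⟩
  map (c ∘ k) (map inj₁ as) ++ map (c ∘ k) (map inj₂ bs)  ≡⟨ cong₂ _++_ (map-∘ as) (map-∘ bs) ⟨
  map (c ∘ k ∘ inj₁) as ++ map (c ∘ k ∘ inj₂) bs          ∎
  where open PermutationReasoning

map-map↭ : {A C D : Set} {c : C → D} {k : A → C} {as : List A} {cs : List C} →
  cs ↭ map k as → map c cs ↭ map (c ∘ k) as
map-map↭ {c = c} {as = as} p = ↭-trans (map⁺ c p) (↭-reflexive (sym (map-∘ as)))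

Unique-resp-↭ : {X : Set} {xs ys : List X} → xs ↭ ys → Unique xs → Unique ys
Unique-resp-↭ {X} p = PermSetoid.Unique-resp-↭ (setoid X) (↭.↭⇒↭ₛ p)

Unique-++⁻ : {X : Set} (xs : List X) {ys : List X} → Unique (xs ++ ys) → Unique xs × Unique ys
Unique-++⁻ []       u        = [] , u
Unique-++⁻ (x ∷ xs) (x∉ ∷ u) with Unique-++⁻ xs u
... | uxs , uys = All.++⁻ˡ xs x∉ ∷ uxs , uys

-- The multi-set in which each x listed with multiplicity n occurs n times.
spread : {X : Set} → List (X × ℕ) → List X
spread = concatMap (λ (x , n) → replicate n x)

map-spread : {X Y : Set} (f : X → Y) (n : X → ℕ) (xs : List X) →
  map f (spread (map (λ x → x , n x) xs)) ≡ spread (map (λ x → f x , n x) xs)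
map-spread f n []       = refl
map-spread f n (x ∷ xs) = trans (map-++ f (replicate (n x) x) _)
                                (cong₂ _++_ (map-replicate f (n x) x) (map-spread f n xs))

∈-replicate⁻ : {X : Set} {x y : X} (n : ℕ) → y ∈ replicate n x → y ≡ x
∈-replicate⁻ (suc n) (here eq) = eq
∈-replicate⁻ (suc n) (there p) = ∈-replicate⁻ n p

∈-spread⁻ : {X : Set} {y : X} (cs : List (X × ℕ)) → y ∈ spread cs → ∃[ n ] (y , n) ∈ cs
∈-spread⁻ cs p with find (∈-concatMap⁻ _ {xs = cs} p)
... | (x , n) , c , q with refl ← ∈-replicate⁻ n q = n , c

-- Enumerations of finite types

-- xs lists every element of X exactly once.
record Enumerates {X : Set} (xs : List X) : Set where
  field
    complete : ∀ x → x ∈ xs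
    unique   : Unique xs

open Enumerates

allFin-enumerates : ∀ n → Enumerates (allFin n)
allFin-enumerates n = record { complete = ∈-allFin ; unique = Unique.allFin⁺ n }

elements-enumerates : (F : FiniteSet) → Enumerates (FiniteSet.elements F)
elements-enumerates F = record
  { complete = λ x → subst (_∈ elements) (strictlyInverseʳ x) (∈-map⁺ from (∈-allFin (to x)))
  ; unique   = Unique.map⁺
      (λ {i} {j} eq → trans (sym (strictlyInverseˡ i)) (trans (cong to eq) (strictlyInverseˡ j)))
      (Unique.allFin⁺ size)
  }
  where
  open FiniteSet F
  open Inverse enumeration

⊎-enumerates : {X Y : Set} {xs : List X} {ys : List Y} → Enumerates xs → Enumerates ys →
  Enumerates (map inj₁ xs ++ map inj₂ ys)
⊎-enumerates {xs = xs} ex ey = record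
  { complete = λ { (inj₁ x) → ∈-++⁺ˡ (∈-map⁺ inj₁ (complete ex x))
                 ; (inj₂ y) → ∈-++⁺ʳ (map inj₁ xs) (∈-map⁺ inj₂ (complete ey y)) }
  ; unique   = Unique.++⁺ (Unique.map⁺ inj₁-injective (unique ex)) (Unique.map⁺ inj₂-injective (unique ey)) disjoint
  }
  where
  disjoint : Disjoint (map inj₁ xs) (map inj₂ _)
  disjoint (p , q) with ∈-map⁻ inj₁ p | ∈-map⁻ inj₂ q
  ... | _ , _ , refl | _ , _ , ()

-- The pairs of an x in the list and an i < size x.
fibres : {X : Set} (size : X → ℕ) → List X → List (Σ X (Fin ∘ size))
fibres size = concatMap (λ x → map (x ,_) (allFin (size x)))

fibres-enumerates : {X : Set} (size : X → ℕ) {xs : List X} → Enumerates xs → Enumerates (fibres size xs)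
fibres-enumerates {X} size {xs} ex = record
  { complete = λ (x , i) → ∈-concatMap⁺ _ (lose (complete ex x) (∈-map⁺ (x ,_) (∈-allFin i)))
  ; unique   = Unique.concat⁺
      (All.map⁺ (All.universal (λ x → Unique.map⁺ (λ { refl → refl }) (Unique.allFin⁺ (size x))) xs))
      (AllPairs.map⁺ (AllPairs.map disjoint (unique ex)))
  }
  where
  disjoint : ∀ {x y} → x ≢ y → Disjoint (map (x ,_) (allFin (size x))) (map (y ,_) (allFin (size y)))
  disjoint x≢y (p , q) with ∈-map⁻ _ p | ∈-map⁻ _ q
  ... | _ , _ , refl | _ , _ , refl = x≢y refl

map-proj₁-fibres : {X : Set} (size : X → ℕ) (xs : List X) →
  map proj₁ (fibres size xs) ≡ spread (map (λ x → x , size x) xs)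
map-proj₁-fibres size xs = begin
  map proj₁ (fibres size xs)
    ≡⟨ map-concatMap proj₁ _ xs ⟩
  concatMap (λ x → map proj₁ (map (x ,_) (allFin (size x)))) xs
    ≡⟨ concatMap-cong (λ x → trans (sym (map-∘ (allFin (size x)))) (map-const x (size x))) xs ⟩
  concatMap (λ x → replicate (size x) x) xs
    ≡⟨ concatMap-map _ _ xs ⟨
  spread (map (λ x → x , size x) xs) ∎
  where
  open ≡-Reasoning
  map-const : {X : Set} (x : X) (n : ℕ) → map (λ (_ : Fin n) → x) (allFin n) ≡ replicate n x
  map-const x zero    = refl
  map-const x (suc n) = cong (x ∷_)
    (trans (map-tabulate Fin.suc _) (trans (sym (map-tabulate id _)) (map-const x n)))

injective-on : {X Y : Set} {xs : List X} {f : X → Y} → Enumerates xs → Unique (map f xs) → Injective _≡_ _≡_ f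
injective-on {f = f} ex u {x} {y} = go (AllPairs.map⁻ u) (complete ex x) (complete ex y)
  where
  go : ∀ {xs} → AllPairs (λ x y → f x ≢ f y) xs → ∀ {x y} → x ∈ xs → y ∈ xs → f x ≡ f y → x ≡ y
  go (_  ∷ _) (here refl) (here refl) eq = refl
  go (ne ∷ _) (here refl) (there q)   eq = contradiction eq (All.lookup ne q)
  go (ne ∷ _) (there p)   (here refl) eq = contradiction (sym eq) (All.lookup ne p)
  go (_  ∷ u) (there p)   (there q)   eq = go u p q eq

-- The set of positions of a list.
listed : {X : Set} → List X → FiniteSet
listed xs = record { Carrier = Fin (length xs) ; size = length xs ; enumeration = ↔-id _ }

map-lookup-allFin : {X : Set} (xs : List X) → map (lookup xs) (allFin (length xs)) ≡ xs
map-lookup-allFin xs = trans (map-tabulate id (lookup xs)) (tabulate-lookup xs)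

lookup-allFin↭ : {X : Set} (xs : List X) → xs ↭ map (lookup xs) (allFin (length xs))
lookup-allFin↭ xs = ↭-reflexive (sym (map-lookup-allFin xs))

lookup-elements↭ : {X : Set} (xs : List X) → xs ↭ map (lookup xs) (FiniteSet.elements (listed xs))
lookup-elements↭ xs = ↭-reflexive
  (sym (trans (cong (map (lookup xs)) (map-id (allFin (length xs)))) (map-lookup-allFin xs)))

lookup-injective : {X : Set} {xs : List X} → Unique xs → Injective _≡_ _≡_ (lookup xs)
lookup-injective {xs = xs} u =
  injective-on (allFin-enumerates _) (subst Unique (sym (map-lookup-allFin xs)) u)

-- Functions read off from multi-sets of pairs

-- If the images of the as under p are, as a multi-set, the images of X under
-- h, then the as are the values of a function g on X lying over h.
relabel : {X A B : Set} {xs : List X} → Enumerates xs → {p : A → B} {h : X → B} {as : List A} →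
  map p as ↭ map h xs → ∃[ g ] (∀ x → p (g x) ≡ h x) × as ↭ map g xs
relabel {X} {A} {B} {xs} ex {p} {h} perm with bs , eq , as↭bs ← ↭-map-inv _ perm =
  g , (λ x → proj₂ (All.lookup matches (complete ex x))) ,
  ↭-trans as↭bs (↭-reflexive (trans (sym (reduce-matching xs bs eq)) (sym (map-as-reduce matches g agree))))
  where
  Match : X → Set
  Match x = Σ[ a ∈ A ] p a ≡ h x

  matching : (xs : List X) (bs : List A) → map h xs ≡ map p bs → All Match xs
  matching []       []       eq = []
  matching (x ∷ xs) (b ∷ bs) eq = (b , sym (∷-injectiveˡ eq)) ∷ matching xs bs (∷-injectiveʳ eq)

  reduce-matching : (xs : List X) (bs : List A) (eq : map h xs ≡ map p bs) →
    All.reduce proj₁ (matching xs bs eq) ≡ bs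
  reduce-matching []       []       eq = refl
  reduce-matching (x ∷ xs) (b ∷ bs) eq = cong (b ∷_) (reduce-matching xs bs _)

  matches : All Match xs
  matches = matching xs bs eq

  g : X → A
  g x = proj₁ (All.lookup matches (complete ex x))

  -- Each x has only one position in xs, so g does not depend on the position
  -- that completeness provides.
  agree : ∀ {x} (q : x ∈ xs) → g x ≡ proj₁ (All.lookup matches q)
  agree q = cong (λ q → proj₁ (All.lookup matches q)) (unique⇒irrelevant (unique ex) _ q)

  map-as-reduce : ∀ {xs} (ms : All Match xs) (g : X → A) →
    (∀ {x} (q : x ∈ xs) → g x ≡ proj₁ (All.lookup ms q)) → map g xs ≡ All.reduce proj₁ ms
  map-as-reduce []       g agree = refl
  map-as-reduce (m ∷ ms) g agree = cong₂ _∷_ (agree (here refl)) (map-as-reduce ms g (agree ∘ there))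

relabel₂ : {X A B : Set} {xs : List X} → Enumerates xs → {h : X → A} {ps : List (A × B)} →
  map proj₁ ps ↭ map h xs → ∃[ f ] ps ↭ map (λ x → h x , f x) xs
relabel₂ {xs = xs} ex perm with g , eq , q ← relabel ex perm =
  proj₂ ∘ g , ↭-trans q (↭-reflexive (map-cong (λ x → cong (_, proj₂ (g x)) (eq x)) xs))

relabel₁ : {X A B : Set} {xs : List X} → Enumerates xs → {h : X → B} {ps : List (A × B)} →
  map proj₂ ps ↭ map h xs → ∃[ f ] ps ↭ map (λ x → f x , h x) xs
relabel₁ {xs = xs} ex perm with g , eq , q ← relabel ex perm =
  proj₁ ∘ g , ↭-trans q (↭-reflexive (map-cong (λ x → cong (proj₁ (g x) ,_) (eq x)) xs))

module _ {D : Set} (_≟_ : DecidableEquality D) where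

  length-filter-map : {X : Set} (f : X → D) (d : D) (xs : List X) →
    length (filter (_≟ d) (map f xs)) ≡ length (filter (λ x → f x ≟ d) xs)
  length-filter-map f d []       = refl
  length-filter-map f d (x ∷ xs) with f x ≟ d
  ... | yes _ = cong suc (length-filter-map f d xs)
  ... | no  _ = length-filter-map f d xs

  count-spread : (n : D → ℕ) {ds : List D} {d : D} → Unique ds → d ∈ ds →
    length (filter (_≟ d) (spread (map (λ d → d , n d) ds))) ≡ n d
  count-spread n {d ∷ ds} (d∉ ∷ u) (here refl) = begin
    length (filter (_≟ d) (replicate (n d) d ++ spread (map (λ d → d , n d) ds)))
      ≡⟨ cong length (filter-++ (_≟ d) (replicate (n d) d) _) ⟩
    length (filter (_≟ d) (replicate (n d) d) ++ filter (_≟ d) (spread (map (λ d → d , n d) ds)))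
      ≡⟨ cong₂ (λ xs ys → length (xs ++ ys))
           (filter-all (_≟ d) (All.replicate⁺ (n d) refl))
           (filter-none (_≟ d) (All.tabulate λ p → λ { refl → absent p })) ⟩
    length (replicate (n d) d ++ [])
      ≡⟨ cong length (++-identityʳ (replicate (n d) d)) ⟩
    length (replicate (n d) d)
      ≡⟨ length-replicate (n d) ⟩
    n d ∎
    where
    open ≡-Reasoning
    absent : d ∉ spread (map (λ d → d , n d) ds)
    absent p with _ , q ← ∈-spread⁻ _ p with _ , r , refl ← ∈-map⁻ (λ d → d , n d) q = All.lookup d∉ r refl
  count-spread n {e ∷ ds} {d} (e∉ ∷ u) (there p) = begin
    length (filter (_≟ d) (replicate (n e) e ++ spread (map (λ d → d , n d) ds)))
      ≡⟨ cong length (filter-++ (_≟ d) (replicate (n e) e) _) ⟩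
    length (filter (_≟ d) (replicate (n e) e) ++ filter (_≟ d) (spread (map (λ d → d , n d) ds)))
      ≡⟨ cong (λ xs → length (xs ++ filter (_≟ d) (spread (map (λ d → d , n d) ds))))
           (filter-none (_≟ d) (All.replicate⁺ (n e) (All.lookup e∉ p))) ⟩
    length (filter (_≟ d) (spread (map (λ d → d , n d) ds)))
      ≡⟨ count-spread n u p ⟩
    n d ∎
    where open ≡-Reasoning

  -- Named arrows, one out of each source, together with one counter for each
  -- destination: if the counters, read as multiplicities, give the multi-set
  -- of targets, then the arrows are the graph of a function from sources to
  -- destinations, and the counters are the sizes of its fibres.
  incidence : {Src A B : Set} {srcs : List Src} {dsts : List D} →
    Enumerates srcs → Enumerates dsts → (srcName : Src → A) (dstName : D → B)
    {arrows : List (A × B)} {counters : List (B × ℕ)} →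
    map proj₁ arrows ↭ map srcName srcs →
    map proj₁ counters ↭ map dstName dsts →
    spread counters ↭ map proj₂ arrows →
    ∃[ f ] arrows ↭ map (λ s → srcName s , dstName (f s)) srcs ×
           counters ↭ map (λ d → dstName d , length (filter (λ s → f s ≟ d) srcs)) dsts
  incidence {srcs = srcs} {dsts} es ed srcName dstName arrowSrcs counterDsts counted
    with e , arrows↭ ← relabel₂ es arrowSrcs
    with n , counters↭ ← relabel₂ ed counterDsts
    with f , dst-f , fs ← relabel es {p = dstName} {h = e} {as = spread (map (λ d → d , n d) dsts)}
      (↭-trans (↭-reflexive (map-spread dstName n dsts))
      (↭-trans (↭-sym (concatMap⁺ _ counters↭))
      (↭-trans counted
      (↭-trans (map⁺ proj₂ arrows↭)
               (↭-reflexive (sym (map-∘ srcs)))))))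
    = f
    , ↭-trans arrows↭ (↭-reflexive (map-cong (λ s → cong (srcName s ,_) (sym (dst-f s))) srcs))
    , ↭-trans counters↭ (↭-reflexive (map-cong (λ d → cong (dstName d ,_) (n-counts d)) dsts))
    where
    n-counts : ∀ d → n d ≡ length (filter (λ s → f s ≟ d) srcs)
    n-counts d = trans (sym (count-spread n (unique ed) (complete ed d)))
                (trans (↭-length (filter-↭ (_≟ d) fs)) (length-filter-map f d srcs))

-- Facts sorted by relation symbol

module _ (𝒮 : Signature) (Name : Sort → Set) where
  open Signature 𝒮

  private
    Fact′ = Fact 𝒮 Name
    MultiSet′ = MultiSet 𝒮 Name

  -- Each of the following functions lists the arguments of the facts of one
  -- relation symbol and is empty on all other facts.
  rootOf : Fact′ → List (Name root)
  rootOf (is-root r) = [ r ]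
  rootOf _           = []

  nodeOf : Fact′ → List (Name node)
  nodeOf (is-node a) = [ a ]
  nodeOf _           = []

  siteOf : Fact′ → List (Name site)
  siteOf (is-site s) = [ s ]
  siteOf _           = []

  portOf : Fact′ → List (Name port)
  portOf (is-port p) = [ p ]
  portOf _           = []

  outerOf : Fact′ → List (Name o-name)
  outerOf (is-o-name o) = [ o ]
  outerOf _             = []

  innerOf : Fact′ → List (Name i-name)
  innerOf (is-i-name i) = [ i ]
  innerOf _             = []

  edgeOf : Fact′ → List (Name e-name)
  edgeOf (is-e-name e) = [ e ]
  edgeOf _             = []

  controlOf : Fact′ → List (Name node × Control)
  controlOf (lc a k) = [ a , k ]
  controlOf _        = []

  ownerOf : Fact′ → List (Name port × Name node)
  ownerOf (lp p a) = [ p , a ]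
  ownerOf _        = []

  prntOf : Fact′ → List (PlaceSrc 𝒮 Name × PlaceDst 𝒮 Name)
  prntOf (prnt s d) = [ s , d ]
  prntOf _          = []

  linkOf : Fact′ → List (LinkSrc 𝒮 Name × LinkDst 𝒮 Name)
  linkOf (link s d) = [ s , d ]
  linkOf _          = []

  childrenOf : Fact′ → List (PlaceDst 𝒮 Name × ℕ)
  childrenOf (has-child-p d n) = [ d , n ]
  childrenOf _                 = []

  linkedOf : Fact′ → List (LinkDst 𝒮 Name × ℕ)
  linkedOf (has-child-l d n) = [ d , n ]
  linkedOf _                 = []

  pendingOf : Fact′ → List (Name node × ℕ)
  pendingOf (vp a n) = [ a , n ]
  pendingOf _        = []

  -- Arguments collected from a multi-set come from one of its facts.
  extract : {A : Set} {w : Fact′ → List A} {c : A → Fact′} → (∀ {a x} → a ∈ w x → c a ≡ x) →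
    ∀ {a S} → a ∈ concatMap w S → c a ∈ S
  extract {w = w} sound {S = S} p with x , x∈S , q ← find (∈-concatMap⁻ w {xs = S} p) =
    subst (_∈ S) (sym (sound q)) x∈S

  pending⇒vp : ∀ {a n x} → (a , n) ∈ pendingOf x → vp a n ≡ x
  pending⇒vp {x = vp _ _} (here refl) = refl

  prntOf⇒prnt : ∀ {s d x} → (s , d) ∈ prntOf x → prnt s d ≡ x
  prntOf⇒prnt {x = prnt _ _} (here refl) = refl

  childrenOf⇒has-child-p : ∀ {d n x} → (d , n) ∈ childrenOf x → has-child-p d n ≡ x
  childrenOf⇒has-child-p {x = has-child-p _ _} (here refl) = refl

  -- Each function restores the facts of one relation symbol and erases all
  -- other facts.
  allKinds : List (Fact′ → MultiSet′)
  allKinds =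
    map is-root ∘ rootOf ∷ map is-node ∘ nodeOf ∷ map is-site ∘ siteOf ∷ map is-port ∘ portOf ∷
    map is-o-name ∘ outerOf ∷ map is-e-name ∘ edgeOf ∷ map is-i-name ∘ innerOf ∷
    map (λ (a , k) → lc a k) ∘ controlOf ∷
    map (λ (p , a) → lp p a) ∘ ownerOf ∷
    map (λ (s , d) → prnt s d) ∘ prntOf ∷
    map (λ (s , d) → link s d) ∘ linkOf ∷
    map (λ (d , n) → has-child-p d n) ∘ childrenOf ∷
    map (λ (d , n) → has-child-l d n) ∘ linkedOf ∷
    map (λ (a , n) → vp a n) ∘ pendingOf ∷ []

  recognise : ∀ x → concatMap (λ h → h x) allKinds ≡ [ x ]
  recognise (is-root _)       = refl
  recognise (is-node _)       = refl
  recognise (is-site _)       = refl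
  recognise (is-port _)       = refl
  recognise (is-o-name _)     = refl
  recognise (is-i-name _)     = refl
  recognise (is-e-name _)     = refl
  recognise (prnt _ _)        = refl
  recognise (link _ _)        = refl
  recognise (lc _ _)          = refl
  recognise (lp _ _)          = refl
  recognise (has-child-p _ _) = refl
  recognise (has-child-l _ _) = refl
  recognise (vp _ _)          = refl

  by-kind : (S : MultiSet′) → S ↭
    map is-root (concatMap rootOf S) ++ map is-node (concatMap nodeOf S) ++
    map is-site (concatMap siteOf S) ++ map is-port (concatMap portOf S) ++
    map is-o-name (concatMap outerOf S) ++ map is-e-name (concatMap edgeOf S) ++
    map is-i-name (concatMap innerOf S) ++
    map (λ (a , k) → lc a k) (concatMap controlOf S) ++
    map (λ (p , a) → lp p a) (concatMap ownerOf S) ++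
    map (λ (s , d) → prnt s d) (concatMap prntOf S) ++
    map (λ (s , d) → link s d) (concatMap linkOf S) ++
    map (λ (d , n) → has-child-p d n) (concatMap childrenOf S) ++
    map (λ (d , n) → has-child-l d n) (concatMap linkedOf S) ++
    map (λ (a , n) → vp a n) (concatMap pendingOf S)
  by-kind S = begin
    S                                                      ≡⟨ concatMap-pure S ⟨
    concatMap [_] S                                        ≡⟨ concatMap-cong recognise S ⟨
    concatMap (λ x → concatMap (λ h → h x) allKinds) S     ↭⟨ concatMap-swap allKinds S ⟩
    concatMap (λ h → concatMap h S) allKinds
      ↭⟨ gather is-root rootOf (gather is-node nodeOf (gather is-site siteOf (gather is-port portOf
         (gather is-o-name outerOf (gather is-e-name edgeOf (gather is-i-name innerOf
         (gather _ controlOf (gather _ ownerOf (gather _ prntOf (gather _ linkOf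
         (gather _ childrenOf (gather _ linkedOf
         (↭-trans (gather _ pendingOf ↭-refl) (↭-reflexive (++-identityʳ _))))))))))))))) ⟩
    _ ∎
    where
    open PermutationReasoning
    gather : {A : Set} (c : A → Fact′) (w : Fact′ → List A) {T U : MultiSet′} → T ↭ U →
      concatMap (map c ∘ w) S ++ T ↭ map c (concatMap w S) ++ U
    gather c w = ++⁺ (↭-reflexive (sym (map-concatMap c w S)))

  -- Conservation laws

  -- Every rule consumes one and the same list C of contributions to f and to
  -- g; the remaining contributions are those of the facts that it produces.
  Conserved : {X : Set} → (f g : Fact′ → List X) → Set
  Conserved f g = ∀ {L R} → Rule 𝒮 Name L R →
    ∃[ C ] concatMap f L ≡ C ++ concatMap f R × concatMap g L ≡ C ++ concatMap g R

  _⇝_ : MultiSet′ → MultiSet′ → Set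
  _⇝_ = _⟶_ 𝒮 Name

  conservation : {X : Set} {f g : Fact′ → List X} → Conserved f g →
    ∀ {S} → S ⇝ [] → concatMap f S ↭ concatMap g S
  conservation law ε = ↭-refl
  conservation {f = f} {g} law {S} (_◅_ {j = S′} (L , R , Δ , rule , S↭ , S′↭) rest)
    with C , fL , gL ← law rule = begin
    concatMap f S       ↭⟨ split f fL ⟩
    C ++ concatMap f S′ ↭⟨ ++⁺ˡ C (conservation law rest) ⟩
    C ++ concatMap g S′ ↭⟨ split g gL ⟨
    concatMap g S       ∎
    where
    open PermutationReasoning
    split : ∀ h → concatMap h L ≡ C ++ concatMap h R → concatMap h S ↭ C ++ concatMap h S′
    split h eq = begin
      concatMap h S                          ↭⟨ concatMap⁺ h S↭ ⟩
      concatMap h (L ++ Δ)                   ≡⟨ concatMap-++ h L Δ ⟩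
      concatMap h L ++ concatMap h Δ         ≡⟨ cong (_++ concatMap h Δ) eq ⟩
      (C ++ concatMap h R) ++ concatMap h Δ  ≡⟨ ++-assoc C _ _ ⟩
      C ++ concatMap h R ++ concatMap h Δ    ≡⟨ cong (C ++_) (concatMap-++ h R Δ) ⟨
      C ++ concatMap h (R ++ Δ)              ↭⟨ ++⁺ˡ C (concatMap⁺ h S′↭) ⟨
      C ++ concatMap h S′                    ∎

  nodes-controls : Conserved (map proj₁ ∘ controlOf) nodeOf
  nodes-controls dr         = [] , refl , refl
  nodes-controls do′        = [] , refl , refl
  nodes-controls de         = [] , refl , refl
  nodes-controls lgpsz      = [] , refl , refl
  nodes-controls lgi        = [] , refl , refl
  nodes-controls lgs        = [] , refl , refl
  nodes-controls (pgnz _)   = [ _ ] , refl , refl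
  nodes-controls (pgns _ _) = [ _ ] , refl , refl
  nodes-controls lgps       = [] , refl , refl

  ports-owners : Conserved portOf (map proj₁ ∘ ownerOf)
  ports-owners dr         = [] , refl , refl
  ports-owners do′        = [] , refl , refl
  ports-owners de         = [] , refl , refl
  ports-owners lgpsz      = [ _ ] , refl , refl
  ports-owners lgi        = [] , refl , refl
  ports-owners lgs        = [] , refl , refl
  ports-owners (pgnz _)   = [] , refl , refl
  ports-owners (pgns _ _) = [] , refl , refl
  ports-owners lgps       = [ _ ] , refl , refl

  prnt-sources : Conserved (map proj₁ ∘ prntOf) (λ x → map src-n (nodeOf x) ++ map src-s (siteOf x))
  prnt-sources dr         = [] , refl , refl
  prnt-sources do′        = [] , refl , refl
  prnt-sources de         = [] , refl , refl
  prnt-sources lgpsz      = [] , refl , refl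
  prnt-sources lgi        = [] , refl , refl
  prnt-sources lgs        = [ _ ] , refl , refl
  prnt-sources (pgnz _)   = [ _ ] , refl , refl
  prnt-sources (pgns _ _) = [ _ ] , refl , refl
  prnt-sources lgps       = [] , refl , refl

  link-sources : Conserved (map proj₁ ∘ linkOf) (λ x → map src-i (innerOf x) ++ map src-p (portOf x))
  link-sources dr         = [] , refl , refl
  link-sources do′        = [] , refl , refl
  link-sources de         = [] , refl , refl
  link-sources lgpsz      = [ _ ] , refl , refl
  link-sources lgi        = [ _ ] , refl , refl
  link-sources lgs        = [] , refl , refl
  link-sources (pgnz _)   = [] , refl , refl
  link-sources (pgns _ _) = [] , refl , refl
  link-sources lgps       = [ _ ] , refl , refl

  place-destinations : Conserved (map proj₁ ∘ childrenOf) (λ x → map dst-n (nodeOf x) ++ map dst-r (rootOf x))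
  place-destinations dr         = [ _ ] , refl , refl
  place-destinations do′        = [] , refl , refl
  place-destinations de         = [] , refl , refl
  place-destinations lgpsz      = [] , refl , refl
  place-destinations lgi        = [] , refl , refl
  place-destinations lgs        = [] , refl , refl
  place-destinations (pgnz _)   = [ _ ] , refl , refl
  place-destinations (pgns _ _) = [ _ ] , refl , refl
  place-destinations lgps       = [] , refl , refl

  link-destinations : Conserved (map proj₁ ∘ linkedOf) (λ x → map dst-e (edgeOf x) ++ map dst-o (outerOf x))
  link-destinations dr         = [] , refl , refl
  link-destinations do′        = [ _ ] , refl , refl
  link-destinations de         = [ _ ] , refl , refl
  link-destinations lgpsz      = [] , refl , refl
  link-destinations lgi        = [] , refl , refl
  link-destinations lgs        = [] , refl , refl
  link-destinations (pgnz _)   = [] , refl , refl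
  link-destinations (pgns _ _) = [] , refl , refl
  link-destinations lgps       = [] , refl , refl

  -- A child decrements the counter of its parent, and a counter disappears
  -- only at zero.
  place-counts : Conserved (spread ∘ childrenOf) (map proj₂ ∘ prntOf)
  place-counts dr         = [] , refl , refl
  place-counts do′        = [] , refl , refl
  place-counts de         = [] , refl , refl
  place-counts lgpsz      = [] , refl , refl
  place-counts lgi        = [] , refl , refl
  place-counts lgs        = [ _ ] , refl , refl
  place-counts (pgnz _)   = [ _ ] , refl , refl
  place-counts (pgns _ _) = [ _ ] , refl , refl
  place-counts lgps       = [] , refl , refl

  link-counts : Conserved (spread ∘ linkedOf) (map proj₂ ∘ linkOf)
  link-counts dr         = [] , refl , refl
  link-counts do′        = [] , refl , refl
  link-counts de         = [] , refl , refl
  link-counts lgpsz      = [ _ ] , refl , refl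
  link-counts lgi        = [ _ ] , refl , refl
  link-counts lgs        = [] , refl , refl
  link-counts (pgnz _)   = [] , refl , refl
  link-counts (pgns _ _) = [] , refl , refl
  link-counts lgps       = [ _ ] , refl , refl

  -- Rule pgns trades the arity of a node for a vp counter, and each port of
  -- the node decrements that counter.
  port-counts : Conserved
    (λ x → spread (pendingOf x) ++ spread (map (map₂ arity) (controlOf x)))
    (map proj₂ ∘ ownerOf)
  port-counts dr             = [] , refl , refl
  port-counts do′            = [] , refl , refl
  port-counts de             = [] , refl , refl
  port-counts lgpsz          = [ _ ] , refl , refl
  port-counts lgi            = [] , refl , refl
  port-counts lgs            = [] , refl , refl
  port-counts (pgnz k≡0) rewrite k≡0 = [] , refl , refl
  port-counts (pgns refl _)  = [] , sym (++-identityʳ _) , refl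
  port-counts lgps           = [ _ ] , refl , refl

  collect : {X : Set} {w : Fact′ → List X} {u v : Fact′ → List X} {S : MultiSet′} → S ⇝ [] →
    Conserved w (λ x → u x ++ v x) → concatMap w S ↭ concatMap u S ++ concatMap v S
  collect {u = u} {v} {S} S⇝ law = ↭-trans (conservation law S⇝) (concatMap-⊕ u v S)

  -- Acyclicity of the parent map

  destination-is-node : ∀ {S n b} → S ⇝ [] → has-child-p (dst-n b) n ∈ S → b ∈ concatMap nodeOf S
  destination-is-node {S} {b = b} S⇝ c
    with ∈-++⁻ (concatMap (map dst-n ∘ nodeOf) S)
           (∈-resp-↭ (collect S⇝ place-destinations) (∈-concatMap⁺ (map proj₁ ∘ childrenOf) (lose c (here refl))))
  ... | inj₁ p with a , q , refl ← ∈-map⁻ dst-n (subst (dst-n b ∈_) (sym (map-concatMap dst-n nodeOf S)) p) = q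
  ... | inj₂ p with () ← proj₂ (proj₂ (∈-map⁻ dst-r (subst (dst-n b ∈_) (sym (map-concatMap dst-r rootOf S)) p)))

  parent-is-node : ∀ {S s b} → S ⇝ [] → prnt s (dst-n b) ∈ S → b ∈ concatMap nodeOf S
  parent-is-node {S} S⇝ p
    with _ , q ← ∈-spread⁻ (concatMap childrenOf S) (subst (_ ∈_) (sym (concatMap-concatMap _ childrenOf S))
      (∈-resp-↭ (↭-sym (conservation place-counts S⇝)) (∈-concatMap⁺ (map proj₂ ∘ prntOf) (lose p (here refl)))))
    = destination-is-node S⇝ (extract childrenOf⇒has-child-p q)

  -- S records a as a child of b.
  Child : MultiSet′ → Name node → Name node → Set
  Child S a b = prnt (src-n a) (dst-n b) ∈ S

  rule-nodes : ∀ {L R} → Rule 𝒮 Name L R → concatMap nodeOf R ≡ []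
  rule-nodes dr         = refl
  rule-nodes do′        = refl
  rule-nodes de         = refl
  rule-nodes lgpsz      = refl
  rule-nodes lgi        = refl
  rule-nodes lgs        = refl
  rule-nodes (pgnz _)   = refl
  rule-nodes (pgns _ _) = refl
  rule-nodes lgps       = refl

  -- A rule consuming the prnt fact of a node consumes that node and no other,
  -- and leaves a counter for the parent.
  rule-children : ∀ {L R a b} → Rule 𝒮 Name L R → Child L a b →
    concatMap nodeOf L ≡ [ a ] × (∃[ n ] has-child-p (dst-n b) n ∈ R) ×
    (∀ {a′ b′} → Child L a′ b′ → a′ ≡ a × b′ ≡ b)
  rule-children dr (there (here ()))
  rule-children do′ (there (here ()))
  rule-children de (there (here ()))
  rule-children lgpsz (there (there (there (there (here ())))))
  rule-children lgi (there (there (here ())))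
  rule-children lgs (there (here ()))
  rule-children lgs (there (there (here ())))
  rule-children (pgnz _) (there (there (here refl))) = refl , (_ , here refl) , λ where
    (there (there (here refl))) → refl , refl
    (there (there (there (there (here ())))))
  rule-children (pgnz _) (there (there (there (there (here ())))))
  rule-children (pgns _ _) (there (there (here refl))) = refl , (_ , here refl) , λ where
    (there (there (here refl))) → refl , refl
    (there (there (there (there (here ())))))
  rule-children (pgns _ _) (there (there (there (there (here ())))))
  rule-children lgps (there (there (there (there (here ())))))

  -- By induction on the reduction: before a step, the relation has at most one
  -- pair more than after it, and the child in that pair has no children itself.
  child-wellFounded : ∀ {S} → S ⇝ [] → Unique (concatMap nodeOf S) → WellFounded (Child S)
  child-wellFounded ε u b = acc λ ()
  child-wellFounded {S} (_◅_ {j = S′} (L , R , Δ , rule , S↭ , S′↭) rest) u b =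
    extend (child-wellFounded rest (proj₂ (Unique-++⁻ (concatMap nodeOf L) u′)) b)
    where
    nodes↭ : concatMap nodeOf S ↭ concatMap nodeOf L ++ concatMap nodeOf S′
    nodes↭ = begin
      concatMap nodeOf S                          ↭⟨ concatMap⁺ nodeOf S↭ ⟩
      concatMap nodeOf (L ++ Δ)                   ≡⟨ concatMap-++ nodeOf L Δ ⟩
      concatMap nodeOf L ++ concatMap nodeOf Δ    ≡⟨ cong (λ ns → concatMap nodeOf L ++ ns ++ concatMap nodeOf Δ) (rule-nodes rule) ⟨
      concatMap nodeOf L ++ concatMap nodeOf R ++ concatMap nodeOf Δ ≡⟨ cong (concatMap nodeOf L ++_) (concatMap-++ nodeOf R Δ) ⟨
      concatMap nodeOf L ++ concatMap nodeOf (R ++ Δ) ↭⟨ ++⁺ˡ (concatMap nodeOf L) (concatMap⁺ nodeOf S′↭) ⟨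
      concatMap nodeOf L ++ concatMap nodeOf S′   ∎
      where open PermutationReasoning

    u′ : Unique (concatMap nodeOf L ++ concatMap nodeOf S′)
    u′ = Unique-resp-↭ nodes↭ u

    -- A consumed node cannot reappear, since nodes are listed only once.
    gone : ∀ {a c} → Child L a c → a ∉ concatMap nodeOf S′
    gone p with nodes-L , _ ← rule-children rule p =
      Unique.Unique[x∷xs]⇒x∉xs (subst (λ ns → Unique (ns ++ _)) nodes-L u′)

    kept : ∀ {a c} → Child Δ a c → Child S′ a c
    kept p = ∈-resp-↭ (↭-sym S′↭) (∈-++⁺ʳ R p)

    childless : ∀ {a c x} → Child L a c → ¬ Child S x a
    childless p q with ∈-++⁻ L (∈-resp-↭ S↭ q)
    ... | inj₂ r = gone p (parent-is-node rest (kept r))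
    ... | inj₁ r with _ , (n , h) , only ← rule-children rule p with _ , refl ← only r =
      gone p (destination-is-node rest (∈-resp-↭ (↭-sym S′↭) (∈-++⁺ˡ h)))

    extend : ∀ {b} → Acc (Child S′) b → Acc (Child S) b
    extend (acc rec) = acc λ p → case-child (∈-++⁻ L (∈-resp-↭ S↭ p)) rec
      where
      case-child : ∀ {a b} → Child L a b ⊎ Child Δ a b → (∀ {y} → Child S′ y b → Acc (Child S′) y) → Acc (Child S) a
      case-child (inj₁ p) _   = acc λ q → contradiction q (childless p)
      case-child (inj₂ p) rec = extend (rec (kept p))

  -- The bigraph of a valid multi-set

  module Construction (S : MultiSet 𝒮 Name) (valid : Valid 𝒮 Name S) (vpFree : VpFree 𝒮 Name S) where
    open Valid valid using (reduces) renaming (unique to S-unique)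
    open FiniteSet using (Carrier; elements) renaming (_≟_ to _≟ꟳ_)

    nodes : List (Name node)
    nodes = concatMap nodeOf S
    roots : List (Name root)
    roots = concatMap rootOf S
    sites : List (Name site)
    sites = concatMap siteOf S
    portNames : List (Name port)
    portNames = concatMap portOf S
    outers : List (Name o-name)
    outers = concatMap outerOf S
    edges : List (Name e-name)
    edges = concatMap edgeOf S
    inners : List (Name i-name)
    inners = concatMap innerOf S

    names-unique : Unique roots × Unique nodes × Unique sites × Unique portNames × Unique outers × Unique edges × Unique inners
    names-unique
      with r , u ← Unique-++⁻ (map is-root roots) (Unique-resp-↭ (by-kind S) S-unique)
      with n , u ← Unique-++⁻ (map is-node nodes) u
      with s , u ← Unique-++⁻ (map is-site sites) u
      with p , u ← Unique-++⁻ (map is-port portNames) u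
      with o , u ← Unique-++⁻ (map is-o-name outers) u
      with e , u ← Unique-++⁻ (map is-e-name edges) u
      with i , _ ← Unique-++⁻ (map is-i-name inners) u
      = Unique.map⁻ r , Unique.map⁻ n , Unique.map⁻ s , Unique.map⁻ p , Unique.map⁻ o , Unique.map⁻ e , Unique.map⁻ i

    -- Nodes, edges, inner and outer names are positions in the lists of names.
    V E X Y : FiniteSet
    V = listed nodes
    E = listed edges
    X = listed inners
    Y = listed outers

    nodeName : Carrier V → Name node
    nodeName = lookup nodes
    siteName : Fin (length sites) → Name site
    siteName = lookup sites
    rootName : Fin (length roots) → Name root
    rootName = lookup roots
    edgeName : Carrier E → Name e-name
    edgeName = lookup edges
    innerName : Carrier X → Name i-name
    innerName = lookup inners
    outerName : Carrier Y → Name o-name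
    outerName = lookup outers

    -- The lc facts give each node its control.
    control-tagging : ∃[ ctrl ] concatMap controlOf S ↭ map (λ v → nodeName v , ctrl v) (elements V)
    control-tagging = relabel₂ (elements-enumerates V) (begin
      map proj₁ (concatMap controlOf S)      ≡⟨ map-concatMap proj₁ controlOf S ⟩
      concatMap (map proj₁ ∘ controlOf) S    ↭⟨ conservation nodes-controls reduces ⟩
      nodes                                  ↭⟨ lookup-elements↭ nodes ⟩
      map nodeName (elements V)              ∎)
      where open PermutationReasoning

    ctrl : Carrier V → Control
    ctrl = proj₁ control-tagging

    Port : Set
    Port = Σ (Carrier V) (Fin ∘ arity ∘ ctrl)

    ports : List Port
    ports = fibres (arity ∘ ctrl) (elements V)

    ports-enumerates : Enumerates ports
    ports-enumerates = fibres-enumerates (arity ∘ ctrl) (elements-enumerates V)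

    pending-empty : concatMap pendingOf S ≡ []
    pending-empty with concatMap pendingOf S in eq
    ... | []          = refl
    ... | (a , n) ∷ _ = contradiction (extract pending⇒vp (subst ((a , n) ∈_) (sym eq) (here refl))) (vpFree a n)

    -- In the absence of vp facts each node owns as many ports as its arity.
    owners↭ : map proj₂ (concatMap ownerOf S) ↭ map (nodeName ∘ proj₁) ports
    owners↭ = begin
      map proj₂ (concatMap ownerOf S)      ≡⟨ map-concatMap proj₂ ownerOf S ⟩
      concatMap (map proj₂ ∘ ownerOf) S    ↭⟨ charged ⟨
      concatMap (spread ∘ pendingOf) S ++ concatMap (spread ∘ map (map₂ arity) ∘ controlOf) S
        ≡⟨ cong (_++ concatMap (spread ∘ map (map₂ arity) ∘ controlOf) S)
                (trans (sym (concatMap-concatMap _ pendingOf S)) (cong spread pending-empty)) ⟩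
      concatMap (spread ∘ map (map₂ arity) ∘ controlOf) S
        ≡⟨ concatMap-concatMap _ (map (map₂ arity) ∘ controlOf) S ⟨
      spread (concatMap (map (map₂ arity) ∘ controlOf) S)
        ≡⟨ cong spread (map-concatMap (map₂ arity) controlOf S) ⟨
      spread (map (map₂ arity) (concatMap controlOf S))
        ↭⟨ concatMap⁺ _ (map⁺ (map₂ arity) (proj₂ control-tagging)) ⟩
      spread (map (map₂ arity) (map (λ v → nodeName v , ctrl v) (elements V)))
        ≡⟨ cong spread (map-∘ (elements V)) ⟨
      spread (map (λ v → nodeName v , arity (ctrl v)) (elements V))
        ≡⟨ map-spread nodeName (arity ∘ ctrl) (elements V) ⟨
      map nodeName (spread (map (λ v → v , arity (ctrl v)) (elements V)))
        ≡⟨ cong (map nodeName) (map-proj₁-fibres (arity ∘ ctrl) (elements V)) ⟨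
      map nodeName (map proj₁ ports)
        ≡⟨ map-∘ ports ⟨
      map (nodeName ∘ proj₁) ports ∎
      where
      open PermutationReasoning
      charged : concatMap (spread ∘ pendingOf) S ++ concatMap (spread ∘ map (map₂ arity) ∘ controlOf) S ↭
                concatMap (map proj₂ ∘ ownerOf) S
      charged = ↭-trans (↭-sym (concatMap-⊕ (spread ∘ pendingOf) _ S)) (conservation port-counts reduces)

    -- A bijection between the pairs (v , i) and the lp facts.
    owner-tagging : ∃[ name ] concatMap ownerOf S ↭ map (λ p → name p , nodeName (proj₁ p)) ports
    owner-tagging = relabel₁ ports-enumerates owners↭

    portName : Port → Name port
    portName = proj₁ owner-tagging

    portNames↭ : portNames ↭ map portName ports
    portNames↭ = begin
      portNames                              ↭⟨ conservation ports-owners reduces ⟩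
      concatMap (map proj₁ ∘ ownerOf) S      ≡⟨ map-concatMap proj₁ ownerOf S ⟨
      map proj₁ (concatMap ownerOf S)        ↭⟨ map⁺ proj₁ (proj₂ owner-tagging) ⟩
      map proj₁ (map (λ p → portName p , nodeName (proj₁ p)) ports) ≡⟨ map-∘ ports ⟨
      map portName ports                     ∎
      where open PermutationReasoning

    -- If the names of two sorts are together in bijection with the w-parts of
    -- the facts, then the latter are indexed by the sum of any two lists that
    -- index the names.
    two-sorts : {A B A′ B′ C : Set} {l : A → C} {r : B → C} {f : A′ → A} {g : B′ → B}
      {u : Fact′ → List A} {v : Fact′ → List B} {as : List A′} {bs : List B′} {w : Fact′ → List C} →
      Conserved w (λ x → map l (u x) ++ map r (v x)) →
      concatMap u S ↭ map f as → concatMap v S ↭ map g bs →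
      concatMap w S ↭ map [ l ∘ f , r ∘ g ]′ (map inj₁ as ++ map inj₂ bs)
    two-sorts {l = l} {r} {f} {g} {u} {v} {as} {bs} {w} law us vs = begin
      concatMap w S                                            ↭⟨ collect reduces law ⟩
      concatMap (map l ∘ u) S ++ concatMap (map r ∘ v) S       ≡⟨ cong₂ _++_ (map-concatMap l u S) (map-concatMap r v S) ⟨
      map l (concatMap u S) ++ map r (concatMap v S)           ↭⟨ ++⁺ (map⁺ l us) (map⁺ r vs) ⟩
      map l (map f as) ++ map r (map g bs)                     ≡⟨ cong₂ _++_ (map-∘ as) (map-∘ bs) ⟨
      map (l ∘ f) as ++ map (r ∘ g) bs                         ≡⟨ cong₂ _++_ (map-∘ as) (map-∘ bs) ⟩
      map k (map inj₁ as) ++ map k (map inj₂ bs)               ≡⟨ map-++ k (map inj₁ as) (map inj₂ bs) ⟨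
      map k (map inj₁ as ++ map inj₂ bs)                       ∎
      where
      open PermutationReasoning
      k = [ l ∘ f , r ∘ g ]′

    placeSrcs : List (Carrier V ⊎ Fin (length sites))
    placeSrcs = map inj₁ (elements V) ++ map inj₂ (allFin (length sites))
    placeDsts : List (Carrier V ⊎ Fin (length roots))
    placeDsts = map inj₁ (elements V) ++ map inj₂ (allFin (length roots))
    linkSrcs : List (Carrier X ⊎ Port)
    linkSrcs = map inj₁ (elements X) ++ map inj₂ ports
    linkDsts : List (Carrier E ⊎ Carrier Y)
    linkDsts = map inj₁ (elements E) ++ map inj₂ (elements Y)

    placeSrcName : Carrier V ⊎ Fin (length sites) → PlaceSrc 𝒮 Name
    placeSrcName = [ src-n ∘ nodeName , src-s ∘ siteName ]′
    placeDstName : Carrier V ⊎ Fin (length roots) → PlaceDst 𝒮 Name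
    placeDstName = [ dst-n ∘ nodeName , dst-r ∘ rootName ]′
    linkSrcName : Carrier X ⊎ Port → LinkSrc 𝒮 Name
    linkSrcName = [ src-i ∘ innerName , src-p ∘ portName ]′
    linkDstName : Carrier E ⊎ Carrier Y → LinkDst 𝒮 Name
    linkDstName = [ dst-e ∘ edgeName , dst-o ∘ outerName ]′

    -- The parent and the link map, whose graphs are the prnt and link facts and
    -- whose fibres are counted by the has-child facts.
    abstract
      placeGraph : Σ[ f ∈ (Carrier V ⊎ Fin (length sites) → Carrier V ⊎ Fin (length roots)) ]
        concatMap prntOf S ↭ map (λ s → placeSrcName s , placeDstName (f s)) placeSrcs ×
        concatMap childrenOf S ↭
          map (λ d → placeDstName d , length (filter (λ s → ≡-dec (_≟ꟳ_ V) Fin._≟_ (f s) d) placeSrcs)) placeDsts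
      placeGraph = incidence (≡-dec (_≟ꟳ_ V) Fin._≟_)
        (⊎-enumerates (elements-enumerates V) (allFin-enumerates _))
        (⊎-enumerates (elements-enumerates V) (allFin-enumerates _))
        placeSrcName placeDstName
        (↭-trans (↭-reflexive (map-concatMap proj₁ prntOf S))
          (two-sorts prnt-sources (lookup-elements↭ nodes) (lookup-allFin↭ sites)))
        (↭-trans (↭-reflexive (map-concatMap proj₁ childrenOf S))
          (two-sorts place-destinations (lookup-elements↭ nodes) (lookup-allFin↭ roots)))
        (↭-trans (↭-reflexive (concatMap-concatMap _ childrenOf S)) (↭-trans (conservation place-counts reduces)
          (↭-reflexive (sym (map-concatMap proj₂ prntOf S)))))

      linkGraph : Σ[ f ∈ (Carrier X ⊎ Port → Carrier E ⊎ Carrier Y) ]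
        concatMap linkOf S ↭ map (λ s → linkSrcName s , linkDstName (f s)) linkSrcs ×
        concatMap linkedOf S ↭
          map (λ d → linkDstName d , length (filter (λ s → ≡-dec (_≟ꟳ_ E) (_≟ꟳ_ Y) (f s) d) linkSrcs)) linkDsts
      linkGraph = incidence (≡-dec (_≟ꟳ_ E) (_≟ꟳ_ Y))
        (⊎-enumerates (elements-enumerates X) ports-enumerates)
        (⊎-enumerates (elements-enumerates E) (elements-enumerates Y))
        linkSrcName linkDstName
        (↭-trans (↭-reflexive (map-concatMap proj₁ linkOf S))
          (two-sorts link-sources (lookup-elements↭ inners) portNames↭))
        (↭-trans (↭-reflexive (map-concatMap proj₁ linkedOf S))
          (two-sorts link-destinations (lookup-elements↭ edges) (lookup-elements↭ outers)))
        (↭-trans (↭-reflexive (concatMap-concatMap _ linkedOf S)) (↭-trans (conservation link-counts reduces)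
          (↭-reflexive (sym (map-concatMap proj₂ linkOf S)))))

    prntB : Carrier V ⊎ Fin (length sites) → Carrier V ⊎ Fin (length roots)
    prntB = proj₁ placeGraph

    linkB : Carrier X ⊎ Port → Carrier E ⊎ Carrier Y
    linkB = proj₁ linkGraph

    parent-fact : ∀ {w v} → prntB (inj₁ w) ≡ inj₁ v → Child S (nodeName w) (nodeName v)
    parent-fact {w} {v} eq = extract {w = prntOf} {c = λ (s , d) → prnt s d} prntOf⇒prnt recorded
      where
      nameEdge : Carrier V ⊎ Fin (length sites) → PlaceSrc 𝒮 Name × PlaceDst 𝒮 Name
      nameEdge s = placeSrcName s , placeDstName (prntB s)
      recorded : (src-n (nodeName w) , dst-n (nodeName v)) ∈ concatMap prntOf S
      recorded = ∈-resp-↭ (↭-sym (proj₁ (proj₂ placeGraph)))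
        (subst (λ d → (src-n (nodeName w) , placeDstName d) ∈ map nameEdge placeSrcs) eq
          (∈-map⁺ nameEdge {x = inj₁ w} (∈-++⁺ˡ (∈-map⁺ inj₁ (complete (elements-enumerates V) w)))))

    prnt-wellFounded : WellFounded (λ w v → prntB (inj₁ w) ≡ inj₁ v)
    prnt-wellFounded = Subrelation.wellFounded parent-fact
      (On.wellFounded nodeName (child-wellFounded reduces (proj₁ (proj₂ names-unique))))

    B : Bigraph 𝒮 ⟨ length sites , X ⟩ ⟨ length roots , Y ⟩
    B = record
      { V = V ; E = E ; ctrl = ctrl ; prnt = prntB ; link = linkB
      ; acyclic = λ v cycle → wf⇒asym (Plus.wellFounded _ prnt-wellFounded) cycle cycle
      }

    η : Naming 𝒮 Name B
    η with r , n , s , p , o , e , i ← names-unique = record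
      { nodeName  = nodeName
      ; edgeName  = edgeName
      ; portName  = portName
      ; rootName  = rootName
      ; siteName  = siteName
      ; innerName = innerName
      ; outerName = outerName
      ; nodeName-injective  = lookup-injective n
      ; edgeName-injective  = lookup-injective e
      ; portName-injective  = injective-on ports-enumerates (Unique-resp-↭ portNames↭ p)
      ; rootName-injective  = lookup-injective r
      ; siteName-injective  = lookup-injective s
      ; innerName-injective = lookup-injective i
      ; outerName-injective = lookup-injective o
      }

    open Bigraph B using (childCount; linkCount)

    -- The facts of the encoding, with a letter for the kind of entity (R for
    -- roots, N for nodes, and so on) and an index for the relation symbol.
    R₁ R₂ N₁ N₂ N₃ N₄ S₁ S₂ P₁ P₂ P₃ O₁ O₂ E₁ E₂ I₁ I₂ : MultiSet′
    R₁ = map (is-root ∘ rootName) (allFin (length roots))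
    R₂ = map (λ r → has-child-p (dst-r (rootName r)) (childCount (inj₂ r))) (allFin (length roots))
    N₁ = map (is-node ∘ nodeName) (elements V)
    N₂ = map (λ v → lc (nodeName v) (ctrl v)) (elements V)
    N₃ = map (λ v → has-child-p (dst-n (nodeName v)) (childCount (inj₁ v))) (elements V)
    N₄ = map (λ v → prnt (src-n (nodeName v)) (placeDstName (prntB (inj₁ v)))) (elements V)
    S₁ = map (is-site ∘ siteName) (allFin (length sites))
    S₂ = map (λ s → prnt (src-s (siteName s)) (placeDstName (prntB (inj₂ s)))) (allFin (length sites))
    P₁ = map (is-port ∘ portName) ports
    P₂ = map (λ p → lp (portName p) (nodeName (proj₁ p))) ports
    P₃ = map (λ p → link (src-p (portName p)) (linkDstName (linkB (inj₂ p)))) ports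
    O₁ = map (is-o-name ∘ outerName) (elements Y)
    O₂ = map (λ o → has-child-l (dst-o (outerName o)) (linkCount (inj₂ o))) (elements Y)
    E₁ = map (is-e-name ∘ edgeName) (elements E)
    E₂ = map (λ e → has-child-l (dst-e (edgeName e)) (linkCount (inj₁ e))) (elements E)
    I₁ = map (is-i-name ∘ innerName) (elements X)
    I₂ = map (λ x → link (src-i (innerName x)) (linkDstName (linkB (inj₁ x)))) (elements X)

    encoding-columns : ⟦_⟧ 𝒮 Name B η ↭
      (R₁ ++ R₂ ++ []) ++ (N₁ ++ N₂ ++ N₃ ++ N₄ ++ []) ++ (S₁ ++ S₂ ++ []) ++ (P₁ ++ P₂ ++ P₃ ++ []) ++
      (O₁ ++ O₂ ++ []) ++ (E₁ ++ E₂ ++ []) ++ (I₁ ++ I₂ ++ [])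
    encoding-columns =
      ++⁺ (rows↭columns (_ ∷ _ ∷ []) (allFin (length roots)))
      (++⁺ (rows↭columns (_ ∷ _ ∷ _ ∷ _ ∷ []) (elements V))
      (++⁺ (rows↭columns (_ ∷ _ ∷ []) (allFin (length sites)))
      (++⁺ (rows↭columns (_ ∷ _ ∷ _ ∷ []) ports)
      (++⁺ (rows↭columns (_ ∷ _ ∷ []) (elements Y))
      (++⁺ (rows↭columns (_ ∷ _ ∷ []) (elements E))
           (rows↭columns (_ ∷ _ ∷ []) (elements X)))))))

    S-columns : S ↭
      R₁ ++ N₁ ++ S₁ ++ P₁ ++ O₁ ++ E₁ ++ I₁ ++ N₂ ++ P₂ ++ (N₄ ++ S₂) ++ (I₂ ++ P₃) ++ (N₃ ++ R₂) ++ (E₂ ++ O₂) ++ []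
    S-columns = ↭-trans (by-kind S)
      (++⁺ (map-map↭ (lookup-allFin↭ roots)) (++⁺ (map-map↭ (lookup-elements↭ nodes))
      (++⁺ (map-map↭ (lookup-allFin↭ sites)) (++⁺ (map-map↭ portNames↭)
      (++⁺ (map-map↭ (lookup-elements↭ outers)) (++⁺ (map-map↭ (lookup-elements↭ edges))
      (++⁺ (map-map↭ (lookup-elements↭ inners)) (++⁺ (map-map↭ (proj₂ control-tagging))
      (++⁺ (map-map↭ (proj₂ owner-tagging))
      (++⁺ (map-⊎ (elements V) (allFin _) (proj₁ (proj₂ placeGraph)))
      (++⁺ (map-⊎ (elements X) ports (proj₁ (proj₂ linkGraph)))
      (++⁺ (map-⊎ (elements V) (allFin _) (proj₂ (proj₂ placeGraph)))
      (++⁺ (map-⊎ (elements E) (elements Y) (proj₂ (proj₂ linkGraph)))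
           (↭-reflexive (cong (map _) pending-empty)))))))))))))))

    regroup : (r₁ r₂ n₁ n₂ n₃ n₄ s₁ s₂ p₁ p₂ p₃ o₁ o₂ e₁ e₂ i₁ i₂ : MultiSet′) →
      (r₁ ++ r₂ ++ []) ++ (n₁ ++ n₂ ++ n₃ ++ n₄ ++ []) ++ (s₁ ++ s₂ ++ []) ++ (p₁ ++ p₂ ++ p₃ ++ []) ++
      (o₁ ++ o₂ ++ []) ++ (e₁ ++ e₂ ++ []) ++ (i₁ ++ i₂ ++ []) ↭
      r₁ ++ n₁ ++ s₁ ++ p₁ ++ o₁ ++ e₁ ++ i₁ ++ n₂ ++ p₂ ++ (n₄ ++ s₂) ++ (i₂ ++ p₃) ++ (n₃ ++ r₂) ++ (e₂ ++ o₂) ++ []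
    regroup = solve 17 (λ r₁ r₂ n₁ n₂ n₃ n₄ s₁ s₂ p₁ p₂ p₃ o₁ o₂ e₁ e₂ i₁ i₂ →
      (r₁ ⊕ r₂ ⊕ id′) ⊕ (n₁ ⊕ n₂ ⊕ n₃ ⊕ n₄ ⊕ id′) ⊕ (s₁ ⊕ s₂ ⊕ id′) ⊕ (p₁ ⊕ p₂ ⊕ p₃ ⊕ id′) ⊕
      (o₁ ⊕ o₂ ⊕ id′) ⊕ (e₁ ⊕ e₂ ⊕ id′) ⊕ (i₁ ⊕ i₂ ⊕ id′) ⊜
      r₁ ⊕ n₁ ⊕ s₁ ⊕ p₁ ⊕ o₁ ⊕ e₁ ⊕ i₁ ⊕ n₂ ⊕ p₂ ⊕ (n₄ ⊕ s₂) ⊕ (i₂ ⊕ p₃) ⊕ (n₃ ⊕ r₂) ⊕ (e₂ ⊕ o₂) ⊕ id′) ↭-refl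
      where open Algebra.Solver.CommutativeMonoid (++-commutativeMonoid {A = Fact′}) renaming (id to id′)

    encoding : ⟦_⟧ 𝒮 Name B η ↭ S
    encoding = ↭-trans encoding-columns
      (↭-trans (regroup R₁ R₂ N₁ N₂ N₃ N₄ S₁ S₂ P₁ P₂ P₃ O₁ O₂ E₁ E₂ I₁ I₂) (↭-sym S-columns))

theorem1 : (𝒮 : Signature) (Name : Sort → Set) (S : MultiSet 𝒮 Name) →
    Valid 𝒮 Name S → VpFree 𝒮 Name S →
    Σ[ inner ∈ Interface ] Σ[ outer ∈ Interface ] Σ[ B ∈ Bigraph 𝒮 inner outer ] Σ[ η ∈ Naming 𝒮 Name B ]
    ⟦_⟧ 𝒮 Name B η ↭ S
theorem1 𝒮 Name S valid vpFree = _ , _ , B , η , encoding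
  where open Construction 𝒮 Name S valid vpFree
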